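{- For every finite multiset $\Gamma$ and formulas $\varphi,\chi$: if both $\Gamma\Rightarrow\varphi$ and $\varphi,\Gamma\Rightarrow\chi$ are provable in $\mathsf{G4iSLt}$, then $\Gamma\Rightarrow\chi$ is provable in $\mathsf{G4iSLt}$.
   Context: Formulas are built by the grammar $\varphi ::= p \mid \bot \mid \varphi\land\varphi \mid \varphi\lor\varphi \mid \varphi\to\varphi \mid \Box\varphi$, with $p$ ranging over a countably infinite set of propositional variables. For a multiset $\Gamma$, $\Box\Gamma=\{\Box\psi:\psi\in\Gamma\}$; a boxed formula is one of the form $\Box\psi$. A sequent is $\Gamma\Rightarrow\chi$ with $\Gamma$ a finite multiset of formulas and $\chi$ a formula. The sequent calculus $\mathsf{G4iSLt}$ has the following rules, where $p$ is a propositional variable and $\Phi$ always denotes a multiset containing no boxed formula: (⊥L) $\bot,\Gamma\Rightarrow\chi$ (no premise); (IdP) $\Gamma,p\Rightarrow p$ (no premise); (∧L) from $\Gamma,\varphi,\psi\Rightarrow\chi$ infer $\Gamma,\varphi\land\psi\Rightarrow\chi$; (∧R) from $\Gamma\Rightarrow\varphi$ and $\Gamma\Rightarrow\psi$ infer $\Gamma\Rightarrow\varphi\land\psi$; (∨L) from $\Gamma,\varphi\Rightarrow\chi$ and $\Gamma,\psi\Rightarrow\chi$ infer $\Gamma,\varphi\lor\psi\Rightarrow\chi$; (∨R$_i$), $i\in\{1,2\}$: from $\Gamma\Rightarrow\varphi_i$ infer $\Gamma\Rightarrow\varphi_1\lor\varphi_2$; (p→L) from $\Gamma,p,\varphi\Rightarrow\chi$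 infer $\Gamma,p,p\to\varphi\Rightarrow\chi$; (→R) from $\Gamma,\varphi\Rightarrow\psi$ infer $\Gamma\Rightarrow\varphi\to\psi$; (□→L) from $\Phi,\Gamma,\psi,\Box\varphi\Rightarrow\varphi$ and $\Phi,\Box\Gamma,\psi\Rightarrow\chi$ infer $\Phi,\Box\Gamma,\Box\varphi\to\psi\Rightarrow\chi$; (SLtR) from $\Phi,\Gamma,\Box\varphi\Rightarrow\varphi$ infer $\Phi,\Box\Gamma\Rightarrow\Box\varphi$; (∧→L) from $\Gamma,\varphi\to(\psi\to\chi)\Rightarrow\delta$ infer $\Gamma,(\varphi\land\psi)\to\chi\Rightarrow\delta$; (∨→L) from $\Gamma,\varphi\to\chi,\psi\to\chi\Rightarrow\delta$ infer $\Gamma,(\varphi\lor\psi)\to\chi\Rightarrow\delta$; (→→L) from $\Gamma,\psi\to\chi\Rightarrow\varphi\to\psi$ and $\Gamma,\chi\Rightarrow\delta$ infer $\Gamma,(\varphi\to\psi)\to\chi\Rightarrow\delta$. A proof of a sequent $S$ is a finite tree of sequents with root $S$ in which each interior node together with its children forms an instance of a rule (conclusion, premises) and each leaf is the conclusion of a premise-free rule; $S$ is provable if it has a proof. -}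

module Defs where

open import Data.List.Base using (List; _∷_; _++_; map)
open import Data.List.Relation.Unary.All using (All)
open import Data.List.Relation.Binary.Permutation.Propositional using (_↭_)
open import Data.Nat.Base using (ℕ)
open import Relation.Nullary.Negation.Core using (¬_)

infixr 7 _∧_
infixr 6 _∨_
infixr 5 _⊃_
infixr 8 □_
infix  2 _⇒_

data Formula : Set where
  var         : ℕ → Formula
  ⊥           : Formula
  _∧_ _∨_ _⊃_ : Formula → Formula → Formula
  □_          : Formula → Formula

data Boxed : Formula → Set where
  boxed : ∀ {φ} → Boxed (□ φ)

BoxFree : List Formula → Set
BoxFree = All (λ φ → ¬ Boxed φ)

-- The antecedent is a list standing for a finite multiset.
record Sequent : Set where
  constructor _⇒_
  field
    antecedent : List Formula
    succedent  : Formula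

-- Lists represent multisets up to _↭_. Every rule accepts as its conclusion
-- any list Δ that is a permutation of the displayed antecedent, so the rules
-- are those on multisets and there is no separate exchange rule; provability
-- does not depend on the chosen list.
data Provable : Sequent → Set where

  ⊥L   : ∀ {Δ Γ χ} → Δ ↭ ⊥ ∷ Γ →
         Provable (Δ ⇒ χ)

  IdP  : ∀ {Δ Γ p} → Δ ↭ var p ∷ Γ →
         Provable (Δ ⇒ var p)

  ∧L   : ∀ {Δ Γ φ ψ χ} → Δ ↭ (φ ∧ ψ) ∷ Γ →
         Provable (φ ∷ ψ ∷ Γ ⇒ χ) →
         Provable (Δ ⇒ χ)

  ∧R   : ∀ {Γ φ ψ} →
         Provable (Γ ⇒ φ) →
         Provable (Γ ⇒ ψ) →
         Provable (Γ ⇒ φ ∧ ψ)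

  ∨L   : ∀ {Δ Γ φ ψ χ} → Δ ↭ (φ ∨ ψ) ∷ Γ →
         Provable (φ ∷ Γ ⇒ χ) →
         Provable (ψ ∷ Γ ⇒ χ) →
         Provable (Δ ⇒ χ)

  ∨R₁  : ∀ {Γ φ ψ} →
         Provable (Γ ⇒ φ) →
         Provable (Γ ⇒ φ ∨ ψ)

  ∨R₂  : ∀ {Γ φ ψ} →
         Provable (Γ ⇒ ψ) →
         Provable (Γ ⇒ φ ∨ ψ)

  p→L  : ∀ {Δ Γ p φ χ} → Δ ↭ var p ∷ (var p ⊃ φ) ∷ Γ →
         Provable (var p ∷ φ ∷ Γ ⇒ χ) →
         Provable (Δ ⇒ χ)

  →R   : ∀ {Γ φ ψ} →
         Provable (φ ∷ Γ ⇒ ψ) →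
         Provable (Γ ⇒ φ ⊃ ψ)

  □→L  : ∀ {Δ Φ Γ φ ψ χ} → BoxFree Φ →
         Δ ↭ (□ φ ⊃ ψ) ∷ Φ ++ map □_ Γ →
         Provable (□ φ ∷ ψ ∷ Φ ++ Γ ⇒ φ) →
         Provable (ψ ∷ Φ ++ map □_ Γ ⇒ χ) →
         Provable (Δ ⇒ χ)

  SLtR : ∀ {Δ Φ Γ φ} → BoxFree Φ →
         Δ ↭ Φ ++ map □_ Γ →
         Provable (□ φ ∷ Φ ++ Γ ⇒ φ) →
         Provable (Δ ⇒ □ φ)

  ∧→L  : ∀ {Δ Γ φ ψ χ δ} → Δ ↭ ((φ ∧ ψ) ⊃ χ) ∷ Γ →
         Provable ((φ ⊃ (ψ ⊃ χ)) ∷ Γ ⇒ δ) →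
         Provable (Δ ⇒ δ)

  ∨→L  : ∀ {Δ Γ φ ψ χ δ} → Δ ↭ ((φ ∨ ψ) ⊃ χ) ∷ Γ →
         Provable ((φ ⊃ χ) ∷ (ψ ⊃ χ) ∷ Γ ⇒ δ) →
         Provable (Δ ⇒ δ)

  →→L  : ∀ {Δ Γ φ ψ χ δ} → Δ ↭ ((φ ⊃ ψ) ⊃ χ) ∷ Γ →
         Provable ((ψ ⊃ χ) ∷ Γ ⇒ φ ⊃ ψ) →
         Provable (χ ∷ Γ ⇒ δ) →
         Provable (Δ ⇒ δ)

{-# OPTIONS --safe #-}

-- The argument is semantic. G4iSLt is sound for finite tree-shaped Kripke models
-- of iSL (the modal relation is transitive, conversely well-founded and contained
-- in the intuitionistic order). Conversely, backward proof search terminates,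
-- because a numeric weight of sequents drops from conclusion to premises, and each
-- failed search yields a countermodel: once no invertible rule applies, a new root
-- is put below the countermodels of the unprovable premises. So every sequent is
-- provable or has a countermodel, and soundness of the two given proofs excludes
-- a countermodel of Γ ⇒ χ.
module Submission where

open import Defs
open import Data.Empty as Empty using (⊥-elim)
open import Data.List.Base using (List; []; _∷_; _++_; map)
open import Data.List.Membership.Propositional using (_∈_; find)
open import Data.List.Membership.Propositional.Properties using (∈-∃++)
open import Data.List.Relation.Binary.Permutation.Propositional
  using (_↭_; ↭-refl; ↭-sym; ↭-trans; ↭-reflexive; prep; swap)
open import Data.List.Relation.Binary.Permutation.Propositional.Properties
  using (All-resp-↭; ∈-resp-↭; map⁺; shift)
open import Data.List.Relation.Binary.Subset.Propositional using (_⊆_)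
open import Data.List.Relation.Binary.Subset.Propositional.Properties
  using (xs⊆xs++ys; xs⊆ys++xs)
open import Data.List.Relation.Unary.All as All using (All; []; _∷_)
open import Data.List.Relation.Unary.All.Properties as Allₚ using ()
open import Data.List.Relation.Unary.Any using (here; there; any?)
open import Data.Nat.Base using (ℕ; suc; _+_; _<_)
open import Data.Nat.Induction using (<-wellFounded)
open import Data.Nat.ListAction using (sum)
open import Data.Nat.ListAction.Properties using (sum-↭)
open import Data.Nat.Properties as ℕ using (m≤m+n)
open import Data.Nat.Tactic.RingSolver using (solve-∀)
open import Data.Product.Base using (∃; _×_; _,_; proj₁; proj₂)
open import Data.Sum.Base as Sum using (_⊎_; inj₁; inj₂)
open import Function.Base using (_∘_; id)
open import Induction.WellFounded using (Acc; acc)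
open import Relation.Binary.PropositionalEquality
  using (_≡_; refl; sym; trans; cong; cong₂; subst)
open import Relation.Nullary using (¬_; Dec; yes; no)
open import Relation.Nullary.Decidable using (map′)

-- Tree models

data Edge : Set where
  weak modal : Edge

-- The label of a node lists the variables true there; its other formulas are
-- irrelevant, but allow the root of a countermodel to be labelled by Γ itself.
data Tree : Set where
  node : List Formula → List (Edge × Tree) → Tree

label : Tree → List Formula
label (node Γ _) = Γ

infix 4 _≼_ _⊏_ _⊩_ _⊩*_

data _≼_ : Tree → Tree → Set where
  ≼-refl : ∀ {t} → t ≼ t
  below  : ∀ {Γ ks e k u} → (e , k) ∈ ks → k ≼ u → node Γ ks ≼ u

-- A path counts as modal once it has at least one modal edge. Hence `⊏` lies inside `≼` and absorbs
-- it on both sides, which makes it transitive.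
data _⊏_ : Tree → Tree → Set where
  via-weak  : ∀ {Γ ks k u} → (weak , k) ∈ ks → k ⊏ u → node Γ ks ⊏ u
  via-modal : ∀ {Γ ks k u} → (modal , k) ∈ ks → k ≼ u → node Γ ks ⊏ u

≼-trans : ∀ {t u v} → t ≼ u → u ≼ v → t ≼ v
≼-trans ≼-refl      q = q
≼-trans (below i p) q = below i (≼-trans p q)

⊏⇒≼ : ∀ {t u} → t ⊏ u → t ≼ u
⊏⇒≼ (via-weak i p)  = below i (⊏⇒≼ p)
⊏⇒≼ (via-modal i p) = below i p

≼-⊏-trans : ∀ {t u v} → t ≼ u → u ⊏ v → t ⊏ v
≼-⊏-trans ≼-refl                  q = q
≼-⊏-trans (below {e = weak}  i p) q = via-weak i (≼-⊏-trans p q)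
≼-⊏-trans (below {e = modal} i p) q = via-modal i (≼-trans p (⊏⇒≼ q))

_⊐_ : Tree → Tree → Set
t ⊐ u = u ⊏ t

-- Generalising from the root to every `u` above `t` makes the induction structural: each `⊏`-step
-- from the root enters a subtree.
⊐-acc : ∀ t {u} → t ≼ u → Acc _⊐_ u
⊐-acc-kids : ∀ ks {e k u} → (e , k) ∈ ks → k ≼ u → Acc _⊐_ u

⊐-acc (node Γ ks) ≼-refl      = acc λ
  { (via-weak i p)  → ⊐-acc-kids ks i (⊏⇒≼ p)
  ; (via-modal i p) → ⊐-acc-kids ks i p }
⊐-acc (node Γ ks) (below i p) = ⊐-acc-kids ks i p

⊐-acc-kids ((_ , k) ∷ ks) (here refl) p = ⊐-acc k p
⊐-acc-kids (_ ∷ ks)       (there i)   p = ⊐-acc-kids ks i p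

-- Labels need not grow along ≼, so persistence is built into the clause for var.
_⊩_ : Tree → Formula → Set
t ⊩ var p = ∀ {u} → t ≼ u → var p ∈ label u
t ⊩ ⊥     = Empty.⊥
t ⊩ φ ∧ ψ = t ⊩ φ × t ⊩ ψ
t ⊩ φ ∨ ψ = t ⊩ φ ⊎ t ⊩ ψ
t ⊩ φ ⊃ ψ = ∀ {u} → t ≼ u → u ⊩ φ → u ⊩ ψ
t ⊩ □ φ   = ∀ {u} → t ⊏ u → u ⊩ φ

_⊩*_ : Tree → List Formula → Set
t ⊩* Γ = All (t ⊩_) Γ

⊩-mono : ∀ φ {t u} → t ≼ u → t ⊩ φ → u ⊩ φ
⊩-mono (var p) l f        = f ∘ ≼-trans l
⊩-mono (φ ∧ ψ) l (f , g)  = ⊩-mono φ l f , ⊩-mono ψ l g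
⊩-mono (φ ∨ ψ) l (inj₁ f) = inj₁ (⊩-mono φ l f)
⊩-mono (φ ∨ ψ) l (inj₂ g) = inj₂ (⊩-mono ψ l g)
⊩-mono (φ ⊃ ψ) l f        = f ∘ ≼-trans l
⊩-mono (□ φ)   l f        = f ∘ ≼-⊏-trans l

⊩*-mono : ∀ {Γ t u} → t ≼ u → t ⊩* Γ → u ⊩* Γ
⊩*-mono l = All.map λ {φ} → ⊩-mono φ l

-- Induction along the converse of `⊏`: successors of `u` are again successors of `t`, so the
-- induction hypothesis supplies `□ φ` at `u`.
⊩-löb : ∀ {φ t} → (∀ {u} → t ⊏ u → u ⊩ □ φ → u ⊩ φ) → t ⊩ □ φ
⊩-löb {φ} {t} step {u} r = go (⊐-acc u ≼-refl) r
  where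
  go : ∀ {u} → Acc _⊐_ u → t ⊏ u → u ⊩ φ
  go (acc rs) r = step r λ r′ → go (rs r′) (≼-⊏-trans (⊏⇒≼ r) r′)

-- Soundness

⊩*-⊏ : ∀ Φ {Θ t u} → t ⊏ u → t ⊩* Φ ++ map □_ Θ → u ⊩* Φ ++ Θ
⊩*-⊏ Φ r f = Allₚ.++⁺ (⊩*-mono (⊏⇒≼ r) (Allₚ.++⁻ˡ Φ f))
  (All.map (λ g → g r) (Allₚ.map⁻ (Allₚ.++⁻ʳ Φ f)))

soundness : ∀ {Γ χ t} → Provable (Γ ⇒ χ) → t ⊩* Γ → t ⊩ χ
soundness (⊥L p) f with () ∷ _ ← All-resp-↭ p f
soundness (IdP p) f with g ∷ _ ← All-resp-↭ p f = g
soundness (∧L p d) f with (g , h) ∷ fs ← All-resp-↭ p f = soundness d (g ∷ h ∷ fs)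
soundness (∧R d e) f = soundness d f , soundness e f
soundness (∨L p d e) f with All-resp-↭ p f
... | inj₁ g ∷ fs = soundness d (g ∷ fs)
... | inj₂ g ∷ fs = soundness e (g ∷ fs)
soundness (∨R₁ d) f = inj₁ (soundness d f)
soundness (∨R₂ d) f = inj₂ (soundness d f)
soundness (p→L {p = q} p d) f with g ∷ h ∷ fs ← All-resp-↭ p f =
  soundness d ((λ {_} → g) ∷ h ≼-refl (λ {_} → g) ∷ fs)
soundness (→R d) f l g = soundness d (g ∷ ⊩*-mono l f)
soundness (□→L {Φ = Φ} {φ = φ} {ψ = ψ} _ p d e) f with g ∷ fs ← All-resp-↭ p f =
  soundness e (g ≼-refl □φ ∷ fs)
  where
  -- At a successor, Löb induction grants `□ φ`, and the persisting implication `g` turns it into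
  -- the `ψ` that the left premise demands.
  □φ = ⊩-löb {φ} λ r b →
    soundness d ((λ {_} → b) ∷ g (⊏⇒≼ r) (λ {_} → b) ∷ ⊩*-⊏ Φ r fs)
soundness (SLtR {Φ = Φ} {φ = φ} _ p d) f =
  ⊩-löb {φ} λ r b → soundness d ((λ {_} → b) ∷ ⊩*-⊏ Φ r (All-resp-↭ p f))
soundness (∧→L p d) f with g ∷ fs ← All-resp-↭ p f =
  soundness d ((λ {_} l a {_} l′ b → g (≼-trans l l′) (⊩-mono _ l′ a , b)) ∷ fs)
soundness (∨→L p d) f with g ∷ fs ← All-resp-↭ p f =
  soundness d ((λ {_} l → g l ∘ inj₁) ∷ (λ {_} l → g l ∘ inj₂) ∷ fs)
soundness (→→L p d e) f with g ∷ fs ← All-resp-↭ p f =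
  soundness e (g ≼-refl (λ {_} → φ⊃ψ) ∷ fs)
  where
  -- `ψ ⊃ χ` is forced because, by persistence, a node forcing `ψ` forces `φ ⊃ ψ`.
  φ⊃ψ = λ {u} → soundness d ((λ {_} l b → g l λ {_} l′ _ → ⊩-mono _ l′ b) ∷ fs) {u}

-- Weights of sequents

-- ℓ and r weigh antecedent and succedent formulas; I φ n is the weight of φ ⊃ ψ
-- in an antecedent when ℓ ψ ≡ n. Every clause is chosen so that each rule has
-- lighter premises; in particular ℓ (□ φ) ≡ ℓ φ makes unboxing harmless.
ℓ r : Formula → ℕ
I : Formula → ℕ → ℕ

ℓ (var _) = 0
ℓ ⊥       = 0
ℓ (φ ∧ ψ) = suc (ℓ φ + ℓ ψ)
ℓ (φ ∨ ψ) = suc (ℓ φ + ℓ ψ)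
ℓ (φ ⊃ ψ) = I φ (ℓ ψ)
ℓ (□ φ)   = ℓ φ

I (var _) n = suc n
I ⊥       n = suc n
I (φ ∧ ψ) n = suc (I φ (I ψ n))
I (φ ∨ ψ) n = suc (I φ n + I ψ n)
I (φ ⊃ ψ) n = suc (ℓ φ + I ψ n + r ψ + n)
I (□ φ)   n = suc (n + ℓ φ + r φ)

r (var _) = 0
r ⊥       = 0
r (φ ∧ ψ) = suc (r φ + r ψ)
r (φ ∨ ψ) = suc (r φ + r ψ)
r (φ ⊃ ψ) = suc (ℓ φ + r ψ)
r (□ φ)   = suc (ℓ φ + r φ)

weight* : List Formula → ℕ
weight* Γ = sum (map ℓ Γ)

weight : List Formula → Formula → ℕ
weight Γ χ = weight* Γ + r χ

weight*-↭ : ∀ {Γ Δ} → Γ ↭ Δ → weight* Γ ≡ weight* Δ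
weight*-↭ p = sum-↭ (map⁺ ℓ p)

-- The explicit slack n turns each weight comparison into a semiring identity.
lighter : ∀ {Γ Δ m} χ → Γ ↭ Δ → ∀ n → suc m + n ≡ weight Δ χ → m < weight Γ χ
lighter {m = m} χ p n eq =
  subst (m <_) (trans eq (cong (_+ r χ) (sym (weight*-↭ p)))) (m≤m+n (suc m) n)

-- Unboxing an antecedent

unbox : Formula → Formula
unbox (□ φ) = φ
unbox φ     = φ

-- The boxed case is the validity of `φ ⊃ □ φ`, which rests on `⊏` lying inside `≼`.
⊩-unbox : ∀ φ {t} → t ⊩ unbox φ → t ⊩ φ
⊩-unbox (var p) f = f
⊩-unbox (φ ∧ ψ) f = f
⊩-unbox (φ ∨ ψ) f = f
⊩-unbox (φ ⊃ ψ) f = f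
⊩-unbox (□ φ)   f = λ l → ⊩-mono φ (⊏⇒≼ l) f

ℓ-unbox : ∀ φ → ℓ (unbox φ) ≡ ℓ φ
ℓ-unbox (var _) = refl
ℓ-unbox ⊥       = refl
ℓ-unbox (_ ∧ _) = refl
ℓ-unbox (_ ∨ _) = refl
ℓ-unbox (_ ⊃ _) = refl
ℓ-unbox (□ _)   = refl

weight*-unbox : ∀ Γ → weight* (map unbox Γ) ≡ weight* Γ
weight*-unbox []      = refl
weight*-unbox (φ ∷ Γ) = cong₂ _+_ (ℓ-unbox φ) (weight*-unbox Γ)

-- `perm` is the shape of the conclusion of a modal rule, `unboxed` that of its premise. Passing
-- through `map unbox` lets weight and forcing be compared formula by formula.
record Split (Γ : List Formula) : Set where
  constructor mkSplit
  field
    {Φ Θ}   : List Formula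
    boxFree : BoxFree Φ
    perm    : Γ ↭ Φ ++ map □_ Θ
    unboxed : map unbox Γ ↭ Φ ++ Θ

split-∷ : ∀ {φ Γ} → ¬ Boxed φ → unbox φ ≡ φ → Split Γ → Split (φ ∷ Γ)
split-∷ ¬b eq (mkSplit b p q) =
  mkSplit (¬b ∷ b) (prep _ p) (↭-trans (↭-reflexive (cong (_∷ _) eq)) (prep _ q))

split : ∀ Γ → Split Γ
split []            = mkSplit [] ↭-refl ↭-refl
split (□ φ ∷ Γ) with mkSplit {Φ} {Θ} b p q ← split Γ =
  mkSplit {Θ = φ ∷ Θ} b
    (↭-trans (prep _ p) (↭-sym (shift (□ φ) Φ _)))
    (↭-trans (prep _ q) (↭-sym (shift φ Φ _)))
split (var p ∷ Γ)   = split-∷ (λ ()) refl (split Γ)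
split (⊥ ∷ Γ)       = split-∷ (λ ()) refl (split Γ)
split ((_ ∧ _) ∷ Γ) = split-∷ (λ ()) refl (split Γ)
split ((_ ∨ _) ∷ Γ) = split-∷ (λ ()) refl (split Γ)
split ((_ ⊃ _) ∷ Γ) = split-∷ (λ ()) refl (split Γ)

weight*-unboxed : ∀ {Γ Δ} → map unbox Γ ↭ Δ → weight* Γ ≡ weight* Δ
weight*-unboxed {Γ} q = trans (sym (weight*-unbox Γ)) (weight*-↭ q)

⊩*-unboxed : ∀ {Γ Δ t} → map unbox Γ ↭ Δ → t ⊩* Δ → All (λ φ → t ⊩ unbox φ) Γ
⊩*-unboxed q f = Allₚ.map⁻ (All-resp-↭ (↭-sym q) f)

-- Proof search

Countermodel : List Formula → Formula → Set
Countermodel Γ χ = ∃ λ t → t ⊩* Γ × ¬ (t ⊩ χ)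

Decided : List Formula → Formula → Set
Decided Γ χ = Provable (Γ ⇒ χ) ⊎ Countermodel Γ χ

DecidedBelow : ℕ → Set
DecidedBelow n = ∀ Γ χ → weight Γ χ < n → Decided Γ χ

∈⇒↭ : ∀ {φ : Formula} {Γ} → φ ∈ Γ → ∃ λ Δ → Γ ↭ φ ∷ Δ
∈⇒↭ {φ} i with ys , zs , refl ← ∈-∃++ i = ys ++ zs , shift φ ys zs

_≟var_ : ∀ p φ → Dec (var p ≡ φ)
p ≟var var q   = map′ (cong var) (λ { refl → refl }) (p ℕ.≟ q)
p ≟var ⊥       = no λ ()
p ≟var (_ ∧ _) = no λ ()
p ≟var (_ ∨ _) = no λ ()
p ≟var (_ ⊃ _) = no λ ()
p ≟var (□ _)   = no λ ()

var∈? : ∀ p Γ → Dec (var p ∈ Γ)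
var∈? p = any? (p ≟var_)

-- Invertible left rules

data Reducible (Γ : List Formula) : Formula → Set where
  ⊥    : Reducible Γ ⊥
  _∧_  : ∀ φ ψ → Reducible Γ (φ ∧ ψ)
  _∨_  : ∀ φ ψ → Reducible Γ (φ ∨ ψ)
  var⊃ : ∀ {p} ψ → var p ∈ Γ → Reducible Γ (var p ⊃ ψ)
  ∧⊃   : ∀ φ ψ χ → Reducible Γ (φ ∧ ψ ⊃ χ)
  ∨⊃   : ∀ φ ψ χ → Reducible Γ (φ ∨ ψ ⊃ χ)

-- Either no left rule applies to the formula, or its rule has a premise that is not invertible.
data Irreducible (Γ : List Formula) : Formula → Set where
  var  : ∀ p → Irreducible Γ (var p)
  □_   : ∀ φ → Irreducible Γ (□ φ)
  var⊃ : ∀ {p ψ} → ¬ var p ∈ Γ → Irreducible Γ (var p ⊃ ψ)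
  ⊥⊃   : ∀ ψ → Irreducible Γ (⊥ ⊃ ψ)
  □⊃   : ∀ φ ψ → Irreducible Γ (□ φ ⊃ ψ)
  ⊃⊃   : ∀ φ ψ χ → Irreducible Γ ((φ ⊃ ψ) ⊃ χ)

classify : ∀ Γ φ → Irreducible Γ φ ⊎ Reducible Γ φ
classify Γ (var p)       = inj₁ (var p)
classify Γ ⊥             = inj₂ ⊥
classify Γ (φ ∧ ψ)       = inj₂ (φ ∧ ψ)
classify Γ (φ ∨ ψ)       = inj₂ (φ ∨ ψ)
classify Γ (□ φ)         = inj₁ (□ φ)
classify Γ (⊥ ⊃ ψ)       = inj₁ (⊥⊃ ψ)
classify Γ (φ ∧ ψ ⊃ χ)   = inj₂ (∧⊃ φ ψ χ)
classify Γ (φ ∨ ψ ⊃ χ)   = inj₂ (∨⊃ φ ψ χ)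
classify Γ ((φ ⊃ ψ) ⊃ χ) = inj₁ (⊃⊃ φ ψ χ)
classify Γ (□ φ ⊃ ψ)     = inj₁ (□⊃ φ ψ)
classify Γ (var p ⊃ ψ) with var∈? p Γ
... | yes i = inj₂ (var⊃ ψ i)
... | no ¬i = inj₁ (var⊃ ¬i)

-- A node forcing the antecedent of a premise forces that of the conclusion, so a countermodel is
-- passed down unchanged.
reduce : ∀ {Γ φ} χ → φ ∈ Γ → Reducible Γ φ → DecidedBelow (weight Γ χ) → Decided Γ χ
reduce χ i ⊥ rec with _ , p ← ∈⇒↭ i = inj₁ (⊥L p)
reduce χ i (φ ∧ ψ) rec with Δ , p ← ∈⇒↭ i =
  Sum.map (∧L p) (λ { (t , f ∷ g ∷ fs , ¬c) → t , All-resp-↭ (↭-sym p) ((f , g) ∷ fs) , ¬c })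
    (rec (φ ∷ ψ ∷ Δ) χ (lighter χ p 0 (eq (ℓ φ) (ℓ ψ) (weight* Δ) (r χ))))
  where
  eq : ∀ a b s x → suc (a + (b + s) + x) + 0 ≡ suc (a + b) + s + x
  eq = solve-∀
reduce χ i (φ ∨ ψ) rec with Δ , p ← ∈⇒↭ i
  with rec (φ ∷ Δ) χ (lighter χ p (ℓ ψ) (eq (ℓ φ) (ℓ ψ) (weight* Δ) (r χ)))
  where
  eq : ∀ a b s x → suc (a + s + x) + b ≡ suc (a + b) + s + x
  eq = solve-∀
... | inj₂ (t , f ∷ fs , ¬c) = inj₂ (t , All-resp-↭ (↭-sym p) (inj₁ f ∷ fs) , ¬c)
... | inj₁ d =
  Sum.map (∨L p d) (λ { (t , f ∷ fs , ¬c) → t , All-resp-↭ (↭-sym p) (inj₂ f ∷ fs) , ¬c })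
    (rec (ψ ∷ Δ) χ (lighter χ p (ℓ φ) (eq (ℓ φ) (ℓ ψ) (weight* Δ) (r χ))))
  where
  eq : ∀ a b s x → suc (b + s + x) + a ≡ suc (a + b) + s + x
  eq = solve-∀
reduce χ i (var⊃ {p} ψ j) rec with Δ , q ← ∈⇒↭ i with ∈-resp-↭ q j
... | there j′ with Δ′ , q′ ← ∈⇒↭ j′ =
  Sum.map (p→L perm)
    (λ { (t , f ∷ g ∷ fs , ¬c) →
         t , All-resp-↭ (↭-sym perm) (f ∷ (λ {_} l _ → ⊩-mono ψ l g) ∷ fs) , ¬c })
    (rec (var p ∷ ψ ∷ Δ′) χ (lighter χ perm 0 (eq (ℓ ψ) (weight* Δ′) (r χ))))
  where
  perm = ↭-trans q (↭-trans (prep _ q′) (swap _ _ ↭-refl))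
  eq : ∀ b s x → suc (b + s + x) + 0 ≡ suc b + s + x
  eq = solve-∀
reduce χ i (∧⊃ φ ψ δ) rec with Δ , p ← ∈⇒↭ i =
  Sum.map (∧→L p)
    (λ { (t , f ∷ fs , ¬c) →
         t , All-resp-↭ (↭-sym p) ((λ {_} l (a , b) → f l a ≼-refl b) ∷ fs) , ¬c })
    (rec ((φ ⊃ (ψ ⊃ δ)) ∷ Δ) χ (lighter χ p 0 (eq (I φ (I ψ (ℓ δ))) (weight* Δ) (r χ))))
  where
  eq : ∀ a s x → suc (a + s + x) + 0 ≡ suc a + s + x
  eq = solve-∀
reduce χ i (∨⊃ φ ψ δ) rec with Δ , p ← ∈⇒↭ i =
  Sum.map (∨→L p)
    (λ { (t , f ∷ g ∷ fs , ¬c) →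
         t , All-resp-↭ (↭-sym p) ((λ {_} l → Sum.[ f l , g l ]) ∷ fs) , ¬c })
    (rec ((φ ⊃ δ) ∷ (ψ ⊃ δ) ∷ Δ) χ
      (lighter χ p 0 (eq (I φ (ℓ δ)) (I ψ (ℓ δ)) (weight* Δ) (r χ))))
  where
  eq : ∀ a b s x → suc (a + (b + s) + x) + 0 ≡ suc (a + b) + s + x
  eq = solve-∀

-- Hanging countermodels on a new root

-- Subtrees that may be hung on a root labelled Γ without destroying Γ there.
Admissible : List Formula → Edge × Tree → Set
Admissible Γ (weak  , k) = k ⊩* Γ
Admissible Γ (modal , k) = All (λ φ → k ⊩ unbox φ) Γ

admissible⇒⊩* : ∀ {Γ} e {k} → Admissible Γ (e , k) → k ⊩* Γ
admissible⇒⊩* weak  f = f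
admissible⇒⊩* modal f = All.map (λ {φ} → ⊩-unbox φ) f

-- P can be forced upon the root labelled Γ by hanging suitable subtrees on it,
-- whatever admissible subtrees are hung there for other purposes.
record Achievable (Γ : List Formula) (P : Tree → Set) : Set where
  constructor by-kids
  field
    kids       : List (Edge × Tree)
    admissible : All (Admissible Γ) kids
    suffices   : ∀ {ks} → All (Admissible Γ) ks → kids ⊆ ks → P (node Γ ks)

achieve : ∀ {Γ P} → (∀ {ks} → All (Admissible Γ) ks → P (node Γ ks)) → Achievable Γ P
achieve f = by-kids [] [] λ as _ → f as

achieve-by : ∀ {Γ} {P : Tree → Set} k → Admissible Γ k →
  (∀ {ks} → k ∈ ks → P (node Γ ks)) → Achievable Γ P
achieve-by k a f = by-kids (k ∷ []) (a ∷ []) λ _ s → f (s (here refl))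

achieve-map : ∀ {Γ P Q} → (∀ {ks} → All (Admissible Γ) ks → P (node Γ ks) → Q (node Γ ks)) →
  Achievable Γ P → Achievable Γ Q
achieve-map f (by-kids ks a g) = by-kids ks a λ as s → f as (g as s)

achieve-× : ∀ {Γ P Q} → Achievable Γ P → Achievable Γ Q → Achievable Γ (λ t → P t × Q t)
achieve-× (by-kids ks a f) (by-kids ks′ a′ g) = by-kids (ks ++ ks′) (Allₚ.++⁺ a a′) λ as s →
  f as (s ∘ xs⊆xs++ys ks ks′) , g as (s ∘ xs⊆ys++xs ks′ ks)

refute-⊃ : ∀ {Γ φ ψ k} → k ⊩* Γ → k ⊩ φ → ¬ k ⊩ ψ → Achievable Γ (λ t → ¬ t ⊩ φ ⊃ ψ)
refute-⊃ {k = k} a f ¬g = achieve-by (weak , k) a λ i h → ¬g (h (below i ≼-refl) f)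

refute-□ : ∀ {Γ φ k} → All (λ ψ → k ⊩ unbox ψ) Γ → ¬ k ⊩ φ → Achievable Γ (λ t → ¬ t ⊩ □ φ)
refute-□ {k = k} a ¬f = achieve-by (modal , k) a λ i h → ¬f (h (via-modal i ≼-refl))

refute-persistent : ∀ {Γ} φ {k} → k ⊩* Γ → ¬ k ⊩ φ → Achievable Γ (λ t → ¬ t ⊩ φ)
refute-persistent φ {k} a ¬f =
  achieve-by (weak , k) a λ i h → ¬f (⊩-mono φ (below i ≼-refl) h)

refute-var : ∀ {Γ p} → ¬ var p ∈ Γ → Achievable Γ (λ t → ¬ t ⊩ var p)
refute-var ¬i = achieve λ _ h → ¬i (h ≼-refl)

-- Proper successors of the root force Γ anyway, so only the root matters.
force-⊃ : ∀ {Γ φ ψ} → φ ⊃ ψ ∈ Γ → Achievable Γ (λ t → ¬ t ⊩ φ) → Achievable Γ (_⊩ φ ⊃ ψ)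
force-⊃ i = achieve-map λ
  { as ¬f ≼-refl            f → ⊥-elim (¬f f)
  ; as ¬f (below {e = e} j l) f →
      All.lookup (admissible⇒⊩* e (All.lookup as j)) i l f }

force-var : ∀ {Γ p} → var p ∈ Γ → Achievable Γ (_⊩ var p)
force-var i = achieve λ
  { as ≼-refl              → i
  ; as (below {e = e} j l) → All.lookup (admissible⇒⊩* e (All.lookup as j)) i l }

-- Admissibility is tailored to this: a weak kid forces `□ φ` itself, a modal kid already forces
-- `φ`.
force-□ : ∀ {Γ} φ → □ φ ∈ Γ → Achievable Γ (_⊩ □ φ)
force-□ φ i = achieve λ
  { as (via-weak j l)  → All.lookup (All.lookup as j) i l
  ; as (via-modal j l) → ⊩-mono φ l (All.lookup (All.lookup as j) i) }

-- For `□⊃` and `⊃⊃`, a countermodel of the right premise settles the sequent, and so do proofs of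
-- both premises. Otherwise the countermodel of the left premise becomes a kid that makes the root
-- refute the antecedent of the implication.
force-irreducible : ∀ {Γ φ} χ → φ ∈ Γ → Irreducible Γ φ → DecidedBelow (weight Γ χ) →
  Decided Γ χ ⊎ Achievable Γ (_⊩ φ)
force-irreducible χ i (var p)   rec = inj₂ (force-var i)
force-irreducible χ i (□ φ)     rec = inj₂ (force-□ φ i)
force-irreducible χ i (var⊃ ¬j) rec = inj₂ (force-⊃ i (refute-var ¬j))
force-irreducible χ i (⊥⊃ ψ)    rec = inj₂ (force-⊃ i (achieve λ _ ()))
force-irreducible χ i (□⊃ φ ψ)  rec with Δ , p ← ∈⇒↭ i
  with mkSplit {Φ} {Θ} b q u ← split Δ
  with rec (ψ ∷ Φ ++ map □_ Θ) χ
    (lighter χ (↭-trans p (prep _ q)) (ℓ φ + r φ)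
      (eq (ℓ φ) (r φ) (ℓ ψ) (weight* (Φ ++ map □_ Θ)) (r χ)))
  where
  eq : ∀ a a′ b s x → suc (b + s + x) + (a + a′) ≡ suc (b + a + a′) + s + x
  eq = solve-∀
... | inj₂ (t , f ∷ fs , ¬c) =
  inj₁ (inj₂ (t , All-resp-↭ (↭-sym (↭-trans p (prep _ q)))
    ((λ {_} l _ → ⊩-mono ψ l f) ∷ fs) , ¬c))
... | inj₁ d
  with rec (□ φ ∷ ψ ∷ Φ ++ Θ) φ
    (lighter χ p (r χ)
      (trans (eq (ℓ φ) (r φ) (ℓ ψ) (weight* (Φ ++ Θ)) (r χ))
        (cong (λ s → suc (ℓ ψ + ℓ φ + r φ) + s + r χ) (sym (weight*-unboxed u)))))
  where
  eq : ∀ a a′ b s x → suc (a + (b + s) + a′) + x ≡ suc (b + a + a′) + s + x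
  eq = solve-∀
...   | inj₁ e = inj₁ (inj₁ (□→L b (↭-trans p (prep _ q)) e d))
-- As `t` forces `ψ`, it forces `□ φ ⊃ ψ`; with the unboxed rest this admits it along a modal edge.
...   | inj₂ (t , _ ∷ f ∷ fs , ¬c) = inj₂ (force-⊃ i (refute-□
  (All-resp-↭ (↭-sym p) ((λ {_} l _ → ⊩-mono ψ l f) ∷ ⊩*-unboxed u fs)) ¬c))
force-irreducible χ i (⊃⊃ φ ψ δ) rec with Δ , p ← ∈⇒↭ i
  with rec (δ ∷ Δ) χ
    (lighter χ p (ℓ φ + I ψ (ℓ δ) + r ψ)
      (eq (ℓ φ) (I ψ (ℓ δ)) (r ψ) (ℓ δ) (weight* Δ) (r χ)))
  where
  eq : ∀ a b b′ d s x → suc (d + s + x) + (a + b + b′) ≡ suc (a + b + b′ + d) + s + x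
  eq = solve-∀
... | inj₂ (t , f ∷ fs , ¬c) =
  inj₁ (inj₂ (t , All-resp-↭ (↭-sym p) ((λ {_} l _ → ⊩-mono δ l f) ∷ fs) , ¬c))
... | inj₁ d
  with rec (φ ∷ (ψ ⊃ δ) ∷ Δ) ψ
    (lighter χ p (ℓ δ + r χ)
      (eq (ℓ φ) (I ψ (ℓ δ)) (r ψ) (ℓ δ) (weight* Δ) (r χ)))
  where
  eq : ∀ a b b′ d s x → suc (a + (b + s) + b′) + (d + x) ≡ suc (a + b + b′ + d) + s + x
  eq = solve-∀
...   | inj₁ e = inj₁ (inj₁ (→→L p (→R e) d))
-- Above `t`, where `φ` persists, `φ ⊃ ψ` gives `ψ` and then `g` gives `δ`, so `t` forces the whole
-- implication.
...   | inj₂ (t , f ∷ g ∷ fs , ¬c) = inj₂ (force-⊃ i (refute-⊃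
  (All-resp-↭ (↭-sym p)
    ((λ {_} l h → g l (h ≼-refl (⊩-mono φ l f))) ∷ fs)) f ¬c))

force-antecedent : ∀ {Γ} χ → All (Irreducible Γ) Γ → DecidedBelow (weight Γ χ) →
  Decided Γ χ ⊎ Achievable Γ (_⊩* Γ)
force-antecedent {Γ} χ irr rec = go id irr
  where
  go : ∀ {Δ} → Δ ⊆ Γ → All (Irreducible Γ) Δ → Decided Γ χ ⊎ Achievable Γ (_⊩* Δ)
  go s []       = inj₂ (achieve λ _ → [])
  go s (i ∷ is) with force-irreducible χ (s (here refl)) i rec
  ... | inj₁ d = inj₁ d
  ... | inj₂ f =
    Sum.map₂ (λ g → achieve-map (λ _ (a , as) → a ∷ as) (achieve-× f g)) (go (s ∘ there) is)

-- Conjunctions and implications are always decided here, their right rules being invertible; only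
-- the other succedents may need a new root.
refute-succedent : ∀ Γ χ → DecidedBelow (weight Γ χ) →
  Decided Γ χ ⊎ Achievable Γ (λ t → ¬ t ⊩ χ)
refute-succedent Γ (var p) rec with var∈? p Γ
... | yes i = inj₁ (inj₁ (IdP (proj₂ (∈⇒↭ i))))
... | no ¬i = inj₂ (refute-var ¬i)
refute-succedent Γ ⊥ rec = inj₂ (achieve λ _ ())
refute-succedent Γ (φ ∧ ψ) rec
  with rec Γ φ (lighter {Γ} (φ ∧ ψ) ↭-refl (r ψ) (eq (weight* Γ) (r φ) (r ψ)))
  where
  eq : ∀ s a b → suc (s + a) + b ≡ s + suc (a + b)
  eq = solve-∀
... | inj₂ (t , fs , ¬c) = inj₁ (inj₂ (t , fs , ¬c ∘ proj₁))
... | inj₁ d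
  with rec Γ ψ (lighter {Γ} (φ ∧ ψ) ↭-refl (r φ) (eq (weight* Γ) (r φ) (r ψ)))
  where
  eq : ∀ s a b → suc (s + b) + a ≡ s + suc (a + b)
  eq = solve-∀
...   | inj₂ (t , fs , ¬c) = inj₁ (inj₂ (t , fs , ¬c ∘ proj₂))
...   | inj₁ e = inj₁ (inj₁ (∧R d e))
refute-succedent Γ (φ ∨ ψ) rec
  with rec Γ φ (lighter {Γ} (φ ∨ ψ) ↭-refl (r ψ) (eq (weight* Γ) (r φ) (r ψ)))
  where
  eq : ∀ s a b → suc (s + a) + b ≡ s + suc (a + b)
  eq = solve-∀
... | inj₁ d = inj₁ (inj₁ (∨R₁ d))
... | inj₂ (t , fs , ¬c)
  with rec Γ ψ (lighter {Γ} (φ ∨ ψ) ↭-refl (r φ) (eq (weight* Γ) (r φ) (r ψ)))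
  where
  eq : ∀ s a b → suc (s + b) + a ≡ s + suc (a + b)
  eq = solve-∀
...   | inj₁ e = inj₁ (inj₁ (∨R₂ e))
-- Neither model need refute the other disjunct; hung side by side, they make the root refute both.
...   | inj₂ (u , gs , ¬d) = inj₂ (achieve-map (λ _ (¬f , ¬g) → Sum.[ ¬f , ¬g ])
  (achieve-× (refute-persistent φ fs ¬c) (refute-persistent ψ gs ¬d)))
refute-succedent Γ (φ ⊃ ψ) rec =
  inj₁ (Sum.map →R (λ { (t , f ∷ fs , ¬c) → t , fs , λ g → ¬c (g ≼-refl f) })
    (rec (φ ∷ Γ) ψ (lighter {Γ} (φ ⊃ ψ) ↭-refl 0 (eq (weight* Γ) (ℓ φ) (r ψ)))))
  where
  eq : ∀ s a b → suc (a + s + b) + 0 ≡ s + suc (a + b)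
  eq = solve-∀
refute-succedent Γ (□ φ) rec with mkSplit {Φ} {Θ} b q u ← split Γ
  with rec (□ φ ∷ Φ ++ Θ) φ
    (lighter {Γ} (□ φ) ↭-refl 0
      (trans (eq (weight* (Φ ++ Θ)) (ℓ φ) (r φ))
        (cong (_+ suc (ℓ φ + r φ)) (sym (weight*-unboxed u)))))
  where
  eq : ∀ s a a′ → suc (a + s + a′) + 0 ≡ s + suc (a + a′)
  eq = solve-∀
... | inj₁ d = inj₁ (inj₁ (SLtR b q d))
... | inj₂ (t , _ ∷ fs , ¬c) = inj₂ (refute-□ (⊩*-unboxed u fs) ¬c)

search : ∀ Γ χ → DecidedBelow (weight Γ χ) → Decided Γ χ
search Γ χ rec with All.decide (classify Γ) Γ
... | inj₂ red = let _ , i , φ-red = find red in reduce χ i φ-red rec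
... | inj₁ irr with force-antecedent χ irr rec
...   | inj₁ d = d
...   | inj₂ f with refute-succedent Γ χ rec
...     | inj₁ d = d
-- Each demand tolerates the kids of the other, so a single root meets both.
...     | inj₂ g with by-kids ks as h ← achieve-× f g = inj₂ (node Γ ks , h as id)

-- Completeness and admissibility of cut

completeness : ∀ Γ χ → Decided Γ χ
completeness Γ χ = go Γ χ (<-wellFounded _)
  where
  go : ∀ Γ χ → Acc _<_ (weight Γ χ) → Decided Γ χ
  go Γ χ (acc rs) = search Γ χ λ Γ′ χ′ lt → go Γ′ χ′ (rs lt)

theorem2 : (Γ : List Formula) (φ χ : Formula) →
    Provable (Γ ⇒ φ) → Provable (φ ∷ Γ ⇒ χ) → Provable (Γ ⇒ χ)
theorem2 Γ φ χ d e with completeness Γ χ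
... | inj₁ p            = p
... | inj₂ (t , f , ¬c) = ⊥-elim (¬c (soundness e (soundness d f ∷ f)))
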